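{- Let $G$ be a graph with $\alpha(G)=2$ whose edges are colored with two colors. Suppose that there is a vertex $v\in V(G)$ such that $V(G)\setminus\{v\}$ is the union of the vertex sets of two vertex-disjoint complete subgraphs $K'$ and $K''$ of $G$, and $v$ is adjacent to all but one vertex of $K'$ and to all but one vertex of $K''$. Then $G$ has a $(3,3)$-cover; that is, $V(G)$ can be covered by the vertex sets of two monochromatic subgraphs of $G$, each of diameter at most $3$.
   Context: Graphs are finite and simple; $\alpha(G)$ is the independence number. A monochromatic subgraph is a subgraph (not necessarily induced) all of whose edges have the same color; a single vertex counts as a monochromatic subgraph. The diameter of a graph $H$ is the smallest integer $d$ with $d_H(u,v)\le d$ for all $u,v\in V(H)$, where distances are measured in $H$ itself ($\infty$ if there is no path); a one-vertex graph has diameter $0$. A 2-colored graph $G$ has a $(p,q)$-cover if $V(G)$ is the union of the vertex sets of two monochromatic subgraphs of $G$, one of diameter at most $p$ and the other of diameter at most $q$; the two subgraphs may have the same or different colors and their vertex sets may overlap. -}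

module Defs where

open import Data.Fin using (Fin)
open import Data.Fin.Subset using (Subset; _∈_; _∪_; ⊤; ∣_∣; Nonempty)
open import Data.Nat using (ℕ; zero; suc; _≤_)
open import Data.Product using (_×_; ∃-syntax)
open import Level using (0ℓ)
open import Relation.Binary.Core using (Rel)
open import Relation.Binary.Definitions using (Decidable; Irreflexive; Symmetric)
open import Relation.Binary.PropositionalEquality using (_≡_; _≢_)
open import Relation.Nullary using (¬_)

record Graph (n : ℕ) : Set₁ where
  field
    Adj       : Rel (Fin n) 0ℓ
    adj?      : Decidable Adj
    adj-sym   : Symmetric Adj
    adj-irref : Irreflexive _≡_ Adj

open Graph public

IsLeast : (ℕ → Set) → ℕ → Set
IsLeast P m = P m × (∀ k → P k → m ≤ k)

IsIndependent : ∀ {n} → Graph n → Subset n → Set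
IsIndependent G S = ∀ {u w} → u ∈ S → w ∈ S → ¬ Adj G u w

IsIndependenceNumber : ∀ {n} → Graph n → ℕ → Set
IsIndependenceNumber G k =
  (∃[ S ] (IsIndependent G S × ∣ S ∣ ≡ k)) ×
  (∀ S → IsIndependent G S → ∣ S ∣ ≤ k)

-- Since e and e′ are arbitrary, colour-sym also makes the colour independent
-- of the particular proof of adjacency: a colour is assigned to each
-- unordered edge {u , w}.
record TwoColouring {n : ℕ} (G : Graph n) : Set where
  field
    colour     : ∀ {u w} → Adj G u w → Fin 2
    colour-sym : ∀ {u w} (e : Adj G u w) (e′ : Adj G w u) → colour e ≡ colour e′

open TwoColouring public

-- Not necessarily induced.  Subgraphs have at least one vertex, so that the
-- diameter of an empty graph never comes into play.
record Subgraph {n : ℕ} (G : Graph n) : Set₁ where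
  field
    vertices  : Subset n
    nonempty  : Nonempty vertices
    Edge      : Rel (Fin n) 0ℓ
    edge?     : Decidable Edge
    edge-sym  : Symmetric Edge
    edge⇒adj  : ∀ {u w} → Edge u w → Adj G u w
    -- The other endpoint is covered by edge-sym.
    edge⇒∈    : ∀ {u w} → Edge u w → u ∈ vertices

open Subgraph public

module _ {n : ℕ} {G : Graph n} where

  IsComplete : Subgraph G → Set
  IsComplete H =
    ∀ {u w} → u ∈ vertices H → w ∈ vertices H → u ≢ w → Edge H u w

  IsMonochromatic : TwoColouring G → Subgraph G → Set
  IsMonochromatic χ H =
    ∃[ c ] (∀ {u w} (e : Edge H u w) → colour χ (edge⇒adj H e) ≡ c)

  data Walk (H : Subgraph G) : Fin n → Fin n → ℕ → Set where
    []  : ∀ {u} → Walk H u u zero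
    _∷_ : ∀ {u w x k} → Edge H u w → Walk H w x k → Walk H u x (suc k)

  IsDistance : Subgraph G → Fin n → Fin n → ℕ → Set
  IsDistance H u w = IsLeast (Walk H u w)

  -- An infinite distance is represented by the absence of any k with
  -- IsDistance H u w k, and so is not at most any d.
  DistanceAtMost : Subgraph G → Fin n → Fin n → ℕ → Set
  DistanceAtMost H u w d = ∃[ k ] (IsDistance H u w k × k ≤ d)

  IsDiameter : Subgraph G → ℕ → Set
  IsDiameter H = IsLeast λ d →
    ∀ {u w} → u ∈ vertices H → w ∈ vertices H → DistanceAtMost H u w d

  DiameterAtMost : Subgraph G → ℕ → Set
  DiameterAtMost H p = ∃[ d ] (IsDiameter H d × d ≤ p)

  HasCover : TwoColouring G → ℕ → ℕ → Set₁
  HasCover χ p q = ∃[ H₁ ] ∃[ H₂ ]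
    ( IsMonochromatic χ H₁ × DiameterAtMost H₁ p
    × IsMonochromatic χ H₂ × DiameterAtMost H₂ q
    × vertices H₁ ∪ vertices H₂ ≡ ⊤ )

  -- Exactly one vertex of H is not adjacent to v in G.
  AdjacentToAllButOne : Fin n → Subgraph G → Set
  AdjacentToAllButOne v H = ∃[ x ]
    ( x ∈ vertices H × ¬ Adj G v x
    × (∀ {y} → y ∈ vertices H → y ≢ x → Adj G v y) )

{-# OPTIONS --safe #-}
-- Write K′ = A ∪ {x′} and K″ = B ∪ {x″}, where x′ and x″ are the vertices not
-- adjacent to v; since α(G) = 2, they are adjacent to each other.  In a clique
-- two vertices at distance greater than 2 in one colour are joined by an edge
-- of the other colour which dominates the clique, so a clique is spanned by one
-- colour with diameter at most 3.  A clique minus one edge vx is also spanned in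
-- this way, unless v sends only one colour, and x only the other, to the
-- remaining vertices.  Hence A ∪ {v , x′} and K″, or K′ and B ∪ {v , x″}, form a
-- cover unless the exception occurs on both sides, in which case two stars or
-- single edges suffice.
module Submission where

open import Defs
open import Data.Empty using (⊥; ⊥-elim)
open import Data.Fin using (Fin; zero; suc)
open import Data.Fin.Properties using (_≟_; any?; all?)
open import Data.Fin.Subset
  using (Subset; _∈_; _∉_; _∪_; _∩_; _-_; ⊤; ⁅_⁆; ∣_∣; Empty; Nonempty)
open import Data.Fin.Subset.Properties
  using (_∈?_; ∈⊤; ⊆⊤; ⊆-antisym; x∈⁅x⁆; x∈⁅y⁆⇒x≡y; x∈p∪q⁺; x∈p∪q⁻; x∈p∩q⁺;
         x∈p∧x≢y⇒x∈p-y; x∈p⇒∣p-x∣<∣p∣; p─q─q≡p─q; p─q⊆p)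
open import Data.Nat using (ℕ; zero; suc; _+_; _≤_; _<_; z≤n; s≤s)
open import Data.Nat.Properties
  using (≤-refl; ≤-reflexive; ≤-trans; +-comm; <-irrefl; +-mono-≤; anyUpTo?; <⇒≱; m≤n+m)
open import Data.Product using (_×_; _,_; proj₁; proj₂; ∃; ∃-syntax)
open import Data.Sum as Sum using (_⊎_; inj₁; inj₂; [_,_]′)
open import Function using (_∘_; id)
open import Level using (0ℓ)
open import Relation.Binary.Core using (Rel)
open import Relation.Binary.Definitions using (Decidable)
open import Relation.Binary.PropositionalEquality
  using (_≡_; _≢_; refl; sym; trans; cong; subst; ≢-sym)
open import Relation.Nullary using (¬_; yes; no)
open import Relation.Nullary.Decidable
  using (map′; _×-dec_; _→-dec_; ¬?; decidable-stable)
import Relation.Unary as U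

-- Minimal witnesses and deletion of a vertex.

-- `IsDistance` and `IsDiameter` ask for exact minima, while the arguments below yield upper bounds;
-- searching upwards from zero turns such a bound into the minimum.
least : {P : ℕ → Set} → U.Decidable P → ∀ {m} → P m → ∃[ k ] (IsLeast P k × k ≤ m)
least P? {m} Pm with P? zero
least P? {m}     Pm | yes P0 = zero , (P0 , λ _ _ → z≤n) , z≤n
least P? {zero}  Pm | no ¬P0 = ⊥-elim (¬P0 Pm)
least P? {suc m} Pm | no ¬P0 with least (P? ∘ suc) Pm
... | k , (Pk , k-min) , k≤m =
  suc k , (Pk , λ { zero P0 → ⊥-elim (¬P0 P0) ; (suc j) Pj → s≤s (k-min j Pj) }) , s≤s k≤m

-- A second deletion of `x` changes nothing, yet it would lower the cardinality if `x` were still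
-- present.
x∉p-x : ∀ {n} (p : Subset n) {x : Fin n} → x ∉ p - x
x∉p-x p {x} x∈p-x =
  <-irrefl (cong ∣_∣ (p─q─q≡p─q p ⁅ x ⁆)) (x∈p⇒∣p-x∣<∣p∣ x∈p-x)

x∈p-y⇒x≢y : ∀ {n} (p : Subset n) {x y : Fin n} → x ∈ p - y → x ≢ y
x∈p-y⇒x≢y p x∈p-x refl = x∉p-x p x∈p-x

-- Walks, distances and diameters.

module _ {n : ℕ} {G : Graph n} (H : Subgraph G) where

  walk? : ∀ k → Decidable λ u w → Walk H u w k
  walk? zero u w = map′ (λ { refl → [] }) (λ { [] → refl }) (u ≟ w)
  walk? (suc k) u w =
    map′ (λ (_ , e , p) → e ∷ p) (λ { (e ∷ p) → _ , e , p })
         (any? λ y → edge? H u y ×-dec walk? k y w)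

module _ {n : ℕ} {G : Graph n} {H : Subgraph G} where

  _++_ : ∀ {u w x j k} → Walk H u w j → Walk H w x k → Walk H u x (j + k)
  []      ++ q = q
  (e ∷ p) ++ q = e ∷ (p ++ q)

  -- Distances require only a bound on the length, so the length stays existential instead of being
  -- transported along commutativity of `+`.
  reverse : ∀ {u w k} → Walk H u w k → ∃[ j ] (Walk H w u j × j ≤ k)
  reverse [] = 0 , [] , z≤n
  reverse {k = suc k} (e ∷ p) with reverse p
  ... | j , q , j≤k =
    j + 1 , q ++ (edge-sym H e ∷ []) , ≤-trans (+-mono-≤ j≤k ≤-refl) (≤-reflexive (+-comm k 1))

  walk⇒dist : ∀ {u w j k} → Walk H u w j → j ≤ k → DistanceAtMost H u w k
  walk⇒dist p j≤k with least (λ k → walk? H k _ _) p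
  ... | i , d , i≤j = i , d , ≤-trans i≤j j≤k

  dist-trans : ∀ {u w x j k} →
    DistanceAtMost H u w j → DistanceAtMost H w x k → DistanceAtMost H u x (j + k)
  dist-trans (_ , (p , _) , i≤j) (_ , (q , _) , i′≤k) = walk⇒dist (p ++ q) (+-mono-≤ i≤j i′≤k)

  dist-sym : ∀ {u w k} → DistanceAtMost H u w k → DistanceAtMost H w u k
  dist-sym (_ , (p , _) , i≤k) with reverse p
  ... | _ , q , j≤i = walk⇒dist q (≤-trans j≤i i≤k)

  dist-mono : ∀ {u w j k} → j ≤ k → DistanceAtMost H u w j → DistanceAtMost H u w k
  dist-mono j≤k (i , d , i≤j) = i , d , ≤-trans i≤j j≤k

  dist? : ∀ k → Decidable λ u w → DistanceAtMost H u w k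
  dist? k u w =
    map′ (λ { (_ , s≤s j≤k , p) → walk⇒dist p j≤k }) (λ (j , (p , _) , j≤k) → j , s≤s j≤k , p)
         -- The search is over lengths strictly below its bound, so `suc k` admits exactly the
         -- lengths up to `k`.
         (anyUpTo? (λ j → walk? H j u w) (suc k))

  -- The given uniform bound starts the search for the least one; the property searched is decidable
  -- because its vertices range over `Fin n`.
  diameterAtMost : ∀ {p} →
    (∀ {u w} → u ∈ vertices H → w ∈ vertices H → DistanceAtMost H u w p) → DiameterAtMost H p
  diameterAtMost = least diameter≤?
    where
    diameter≤? : U.Decidable λ d →
      ∀ {u w} → u ∈ vertices H → w ∈ vertices H → DistanceAtMost H u w d
    diameter≤? d =
      map′ (λ f {u} {w} → f u w) (λ f u w → f {u} {w})
           (all? λ u → all? λ w → (u ∈? vertices H) →-dec ((w ∈? vertices H) →-dec dist? d u w))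

-- Coloured edges and closed neighbourhoods.

module Colours {n : ℕ} {G : Graph n} (χ : TwoColouring G) where

  Coloured : Fin 2 → Rel (Fin n) 0ℓ
  Coloured c u w = ∃[ e ] (colour χ {u} {w} e ≡ c)

  coloured-sym : ∀ {c u w} → Coloured c u w → Coloured c w u
  coloured-sym (e , e≡c) = adj-sym G e , trans (colour-sym χ (adj-sym G e) e) e≡c

  coloured? : ∀ c → Decidable (Coloured c)
  coloured? c u w with adj? G u w
  ... | no ¬e = no (¬e ∘ proj₁)
  ... | yes e =
    map′ (e ,_)
         (λ (e′ , e′≡c) →
            -- Two proofs of the same adjacency receive one colour, as both are compared with the
            -- reversed edge.
            trans (colour-sym χ e (adj-sym G e)) (trans (colour-sym χ (adj-sym G e) e′) e′≡c))
         (colour χ e ≟ c)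

  one-of-two : ∀ {c d : Fin 2} → c ≢ d → ∀ a → a ≡ c ⊎ a ≡ d
  one-of-two {zero}     {zero}     c≢d a          = ⊥-elim (c≢d refl)
  one-of-two {zero}     {suc zero} c≢d zero       = inj₁ refl
  one-of-two {zero}     {suc zero} c≢d (suc zero) = inj₂ refl
  one-of-two {suc zero} {zero}     c≢d zero       = inj₂ refl
  one-of-two {suc zero} {zero}     c≢d (suc zero) = inj₁ refl
  one-of-two {suc zero} {suc zero} c≢d a          = ⊥-elim (c≢d refl)

  coloured-either : ∀ {c d u w} → c ≢ d → Adj G u w → Coloured c u w ⊎ Coloured d u w
  coloured-either c≢d e = Sum.map (e ,_) (e ,_) (one-of-two c≢d (colour χ e))

  other-colour : ∀ {c d u w} → c ≢ d → Adj G u w → ¬ Coloured c u w → Coloured d u w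
  other-colour c≢d e ¬e-c = [ ⊥-elim ∘ ¬e-c , id ]′ (coloured-either c≢d e)

  -- The closed neighbourhood of `u` in colour `c`, so that a star covers its own centre.
  Near : Fin 2 → Rel (Fin n) 0ℓ
  Near c u y = y ≡ u ⊎ Coloured c u y

  -- One colour on a vertex set, and far pairs.

  module Span (S : Subset n) (ne : Nonempty S) where

    -- All `c`-edges inside `S` are taken, since further edges can only shorten distances.
    Mono : Fin 2 → Subgraph G
    vertices (Mono c)     = S
    nonempty (Mono c)     = ne
    Edge     (Mono c) u w = u ∈ S × w ∈ S × Coloured c u w
    edge?    (Mono c) u w = (u ∈? S) ×-dec ((w ∈? S) ×-dec coloured? c u w)
    edge-sym (Mono c) (u∈S , w∈S , e) = w∈S , u∈S , coloured-sym e
    edge⇒adj (Mono c) (_ , _ , e , _) = e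
    edge⇒∈   (Mono c) (u∈S , _)       = u∈S

    mono : ∀ c → IsMonochromatic χ (Mono c)
    mono c = c , λ (_ , _ , _ , e≡c) → e≡c

    Dist≤ : ℕ → Fin 2 → Rel (Fin n) 0ℓ
    Dist≤ k c u w = DistanceAtMost (Mono c) u w k

    Spans : Fin 2 → Set
    Spans c = ∀ {u w} → u ∈ S → w ∈ S → Dist≤ 3 c u w

    spans-or-far : ∀ c → Spans c ⊎ (∃[ u ] ∃[ w ] (u ∈ S × w ∈ S × ¬ Dist≤ 3 c u w))
    spans-or-far c
      with any? (λ u → any? λ w →
             (u ∈? S) ×-dec ((w ∈? S) ×-dec ¬? (dist? {H = Mono c} 3 u w)))
    ... | yes far = inj₂ far
    ... | no none = inj₁ λ u∈S w∈S →
      decidable-stable (dist? 3 _ _) λ far → none (_ , _ , u∈S , w∈S , far)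

    dist0 : ∀ {c u} → Dist≤ 0 c u u
    dist0 = walk⇒dist [] z≤n

    dist1 : ∀ {c u w} → u ∈ S → w ∈ S → Coloured c u w → Dist≤ 1 c u w
    dist1 u∈S w∈S e = walk⇒dist ((u∈S , w∈S , e) ∷ []) ≤-refl

    dist-common : ∀ {c u w y} → u ∈ S → y ∈ S → w ∈ S →
      Coloured c u y → Coloured c w y → Dist≤ 3 c u w
    dist-common u∈S y∈S w∈S uy wy =
      dist-mono (m≤n+m 2 1) (dist-trans (dist1 u∈S y∈S uy) (dist-sym (dist1 w∈S y∈S wy)))

    near⇒dist1 : ∀ {c u w} → u ∈ S → w ∈ S → Near c u w → Dist≤ 1 c u w
    near⇒dist1 u∈S w∈S (inj₁ refl) = dist-mono z≤n dist0
    near⇒dist1 u∈S w∈S (inj₂ e)    = dist1 u∈S w∈S e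

    -- The longest route goes from `y` to one centre, across to the other, and on to `z`. Fixing a
    -- single pair `y`, `z` keeps this applicable when some other vertex is not dominated.
    double-star-dist : ∀ {c u w y z} → u ∈ S → w ∈ S → Near c u w →
      y ∈ S → Near c u y ⊎ Near c w y → z ∈ S → Near c u z ⊎ Near c w z → Dist≤ 3 c y z
    double-star-dist {c} {u} {w} u∈S w∈S uw y∈S y-near z∈S z-near = go y-near z-near
      where
      to : ∀ {a t} → a ∈ S → t ∈ S → Near c a t → Dist≤ 1 c a t
      to = near⇒dist1
      go : Near c u _ ⊎ Near c w _ → Near c u _ ⊎ Near c w _ → Dist≤ 3 c _ _
      go (inj₁ uy) (inj₁ uz) =
        dist-mono (m≤n+m 2 1) (dist-trans (dist-sym (to u∈S y∈S uy)) (to u∈S z∈S uz))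
      go (inj₁ uy) (inj₂ wz) =
        dist-trans (dist-trans (dist-sym (to u∈S y∈S uy)) (to u∈S w∈S uw)) (to w∈S z∈S wz)
      go (inj₂ wy) (inj₁ uz) =
        dist-trans (dist-trans (dist-sym (to w∈S y∈S wy)) (dist-sym (to u∈S w∈S uw))) (to u∈S z∈S uz)
      go (inj₂ wy) (inj₂ wz) =
        dist-mono (m≤n+m 2 1) (dist-trans (dist-sym (to w∈S y∈S wy)) (to w∈S z∈S wz))

    -- `Near c u w` allows `u` and `w` to coincide, which gives an ordinary star.
    double-star : ∀ {c u w} → u ∈ S → w ∈ S → Near c u w →
      (∀ {y} → y ∈ S → Near c u y ⊎ Near c w y) → Spans c
    double-star u∈S w∈S uw near y∈S z∈S =
      double-star-dist u∈S w∈S uw y∈S (near y∈S) z∈S (near z∈S)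

    -- The edge `uw` cannot have colour `c`, and a common neighbour cannot be joined to both ends in
    -- `c`, so `uw` is the centre of a double star in `d`. Vertices that may miss an end must be
    -- attached in `d` by the caller through `cases`.
    far⇒dominating : ∀ {c d u w} → c ≢ d → u ∈ S → w ∈ S → Adj G u w → ¬ Dist≤ 3 c u w →
      (∀ {y} → y ∈ S → (Near d u y ⊎ Near d w y) ⊎ (Adj G u y × Adj G w y)) → Spans d
    far⇒dominating {c} {d} {u} {w} c≢d u∈S w∈S uw far cases with coloured-either c≢d uw
    ... | inj₁ uw-c = ⊥-elim (far (dist-mono (m≤n+m 1 2) (dist1 u∈S w∈S uw-c)))
    ... | inj₂ uw-d = double-star u∈S w∈S (inj₂ uw-d) λ y∈S → [ id , both y∈S ]′ (cases y∈S)
      where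
      both : ∀ {y} → y ∈ S → Adj G u y × Adj G w y → Near d u y ⊎ Near d w y
      both y∈S (uy , wy) with coloured-either c≢d uy | coloured-either c≢d wy
      ... | inj₂ uy-d | _         = inj₁ (inj₂ uy-d)
      ... | inj₁ _    | inj₂ wy-d = inj₂ (inj₂ wy-d)
      ... | inj₁ uy-c | inj₁ wy-c =
        ⊥-elim (far (dist-common u∈S y∈S w∈S uy-c wy-c))

    far⇒≢ : ∀ {c u w} → ¬ Dist≤ 3 c u w → u ≢ w
    far⇒≢ far refl = far (dist-mono z≤n dist0)

    clique-spanned : (∀ {u w} → u ∈ S → w ∈ S → u ≢ w → Adj G u w) → ∃ Spans
    clique-spanned adj with spans-or-far zero
    ... | inj₁ spans = zero , spans
    ... | inj₂ (u , w , u∈S , w∈S , far) =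
      suc zero , far⇒dominating {c = zero} (λ ()) u∈S w∈S (adj u∈S w∈S (far⇒≢ far)) far cases
      where
      cases : ∀ {y} → y ∈ S → (Near _ u y ⊎ Near _ w y) ⊎ (Adj G u y × Adj G w y)
      cases {y} y∈S with y ≟ u | y ≟ w
      ... | yes y≡u | _       = inj₁ (inj₁ (inj₁ y≡u))
      ... | no _    | yes y≡w = inj₁ (inj₂ (inj₁ y≡w))
      ... | no y≢u  | no y≢w  = inj₂ (adj u∈S y∈S (≢-sym y≢u) , adj w∈S y∈S (≢-sym y≢w))

    -- Cliques with one pair exempted.

    -- The pair `v`, `x` is exempted from adjacency rather than declared nonadjacent; both orders
    -- are listed so that the two ends can be interchanged.
    CliqueMinusEdge : Rel (Fin n) 0ℓ
    CliqueMinusEdge v x = ∀ {y z} → y ∈ S → z ∈ S → y ≢ z →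
      Adj G y z ⊎ ((y ≡ v × z ≡ x) ⊎ (y ≡ x × z ≡ v))

    Rest : Fin n → Fin n → Fin n → Set
    Rest v x b = b ∈ S × b ≢ v × b ≢ x

    -- The exceptional colouring. For distinct nonadjacent `v` and `x` in `S` it is a true
    -- obstruction: within `S`, `x` is isolated in colour `c` and `v` in colour `d`.
    Split : Rel (Fin n) 0ℓ
    Split v x = ∃[ c ] ∃[ d ] (c ≢ d × (∀ {b} → Rest v x b → Coloured c v b × Coloured d x b))

    split-swap : ∀ {v x} → Split x v → Split v x
    split-swap (c , d , c≢d , split) =
      d , c , ≢-sym c≢d ,
      λ (b∈S , b≢v , b≢x) → let p , q = split (b∈S , b≢x , b≢v) in q , p

    rest? : ∀ v x → U.Decidable (Rest v x)
    rest? v x b = (b ∈? S) ×-dec (¬? (b ≟ v) ×-dec ¬? (b ≟ x))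

    module _ {v x : Fin n} (near-clique : CliqueMinusEdge v x) where

      adj-rest : ∀ {y b} → y ∈ S → Rest v x b → b ≢ y → Adj G y b
      adj-rest y∈S (b∈S , b≢v , b≢x) b≢y with near-clique y∈S b∈S (≢-sym b≢y)
      ... | inj₁ e                = e
      ... | inj₂ (inj₁ (_ , b≡x)) = ⊥-elim (b≢x b≡x)
      ... | inj₂ (inj₂ (_ , b≡v)) = ⊥-elim (b≢v b≡v)

      -- The edge `vb` has colour `d`. If `xb` has colour `d` too, then `vb` dominates `S` in `d`.
      -- Otherwise the outcome depends on whether `v` has a `c`-neighbour `r`, or `x` a
      -- `d`-neighbour `p`, among the remaining vertices; if neither exists, the colouring is split.
      far-from-end : ∀ {c d b} → c ≢ d → v ∈ S → x ∈ S → Rest v x b → ¬ Dist≤ 3 c v b →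
        ∃ Spans ⊎ Split v x
      far-from-end {c} {d} {b} c≢d v∈S x∈S rb@(b∈S , b≢v , b≢x) far
        with coloured-either c≢d (adj-rest v∈S rb b≢v)
      ... | inj₁ vb-c = ⊥-elim (far (dist-mono (m≤n+m 1 2) (dist1 v∈S b∈S vb-c)))
      ... | inj₂ vb-d with coloured-either c≢d (adj-rest x∈S rb b≢x)
      ...   | inj₂ xb-d = inj₁ (d , far⇒dominating c≢d v∈S b∈S (proj₁ vb-d) far cases)
        where
        cases : ∀ {y} → y ∈ S → (Near d v y ⊎ Near d b y) ⊎ (Adj G v y × Adj G b y)
        cases {y} y∈S with y ≟ v | y ≟ x | y ≟ b
        ... | yes y≡v  | _        | _       = inj₁ (inj₁ (inj₁ y≡v))
        -- The vertex `x` may miss `v`, but it hangs from `b` in colour `d`.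
        ... | no _     | yes refl | _       = inj₁ (inj₂ (inj₂ (coloured-sym xb-d)))
        ... | no _     | no _     | yes y≡b = inj₁ (inj₂ (inj₁ y≡b))
        ... | no y≢v   | no y≢x   | no y≢b  =
          let ry = y∈S , y≢v , y≢x in inj₂ (adj-rest v∈S ry y≢v , adj-rest b∈S ry y≢b)
      ...   | inj₁ xb-c
        with any? (λ r → rest? v x r ×-dec coloured? c v r)
           | any? (λ p → rest? v x p ×-dec coloured? d x p)
      ...     | no no-r | yes (p , rp@(p∈S , p≢v , _) , xp-d) =
        -- Here `v` sends `d` to every remaining vertex, and `x` is reached through `p`.
        inj₁ (d , double-star v∈S p∈S (inj₂ (v-d rp)) near)
        where
        v-d : ∀ {y} → Rest v x y → Coloured d v y
        v-d ry@(_ , y≢v , _) =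
          other-colour c≢d (adj-rest v∈S ry y≢v) λ vy-c → no-r (_ , ry , vy-c)
        near : ∀ {y} → y ∈ S → Near d v y ⊎ Near d p y
        near {y} y∈S with y ≟ v | y ≟ x
        ... | yes y≡v | _        = inj₁ (inj₁ y≡v)
        ... | no _    | yes refl = inj₂ (inj₂ (coloured-sym xp-d))
        ... | no y≢v  | no y≢x   = inj₁ (inj₂ (v-d (y∈S , y≢v , y≢x)))
      ...     | no no-r | no no-p = inj₂ (d , c , ≢-sym c≢d , λ ry → v-d ry , x-c ry)
        where
        v-d : ∀ {y} → Rest v x y → Coloured d v y
        v-d ry@(_ , y≢v , _) =
          other-colour c≢d (adj-rest v∈S ry y≢v) λ vy-c → no-r (_ , ry , vy-c)
        x-c : ∀ {y} → Rest v x y → Coloured c x y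
        x-c ry@(_ , _ , y≢x) =
          other-colour (≢-sym c≢d) (adj-rest x∈S ry y≢x) λ xy-d → no-p (_ , ry , xy-d)
      -- The d-edge vb dominates S - x, and x reaches b and v along the d-path x r b v.
      ...     | yes (r , rr@(r∈S , _ , _) , vr-c) | _ = inj₁ (d , spans)
        where
        v-c⇒x-d : ∀ {y} → Rest v x y → Coloured c v y → Coloured d x y
        v-c⇒x-d ry@(y∈S , _ , y≢x) vy-c =
          -- A `c`-edge `xy` would complete the `c`-path `v y x b`.
          other-colour c≢d (adj-rest x∈S ry y≢x) λ xy-c →
            far (dist-trans (dist-trans (dist1 v∈S y∈S vy-c) (dist-sym (dist1 x∈S y∈S xy-c)))
                            (dist1 x∈S b∈S xb-c))

        v-c⇒b-d : ∀ {y} → Rest v x y → Coloured c v y → Coloured d b y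
        v-c⇒b-d {y} ry@(y∈S , _ , _) vy-c with y ≟ b
        ... | yes refl = ⊥-elim (far (dist-mono (m≤n+m 1 2) (dist1 v∈S y∈S vy-c)))
        ... | no y≢b   = other-colour c≢d (adj-rest b∈S ry y≢b) (far ∘ dist-common v∈S y∈S b∈S vy-c)

        near : ∀ {y} → y ∈ S → y ≢ x → Near d v y ⊎ Near d b y
        near {y} y∈S y≢x with y ≟ v
        ... | yes y≡v = inj₁ (inj₁ y≡v)
        ... | no y≢v with coloured-either c≢d (adj-rest v∈S (y∈S , y≢v , y≢x) y≢v)
        ...   | inj₁ vy-c = inj₂ (inj₂ (v-c⇒b-d (y∈S , y≢v , y≢x) vy-c))
        ...   | inj₂ vy-d = inj₁ (inj₂ vy-d)

        x-r : Dist≤ 1 d x r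
        x-r = dist1 x∈S r∈S (v-c⇒x-d rr vr-c)

        r-b : Dist≤ 1 d r b
        r-b = dist-sym (dist1 b∈S r∈S (v-c⇒b-d rr vr-c))

        -- If `vq` has colour `d`, then `q` is reached from `r` or `b` in `d`: two `c`-edges `rq`
        -- and `bq` would give the `c`-path `v r q b`.
        x-rest : ∀ {q} → Rest v x q → Dist≤ 3 d x q
        x-rest {q} rq@(q∈S , q≢v , q≢x) with coloured-either c≢d (adj-rest v∈S rq q≢v)
        ... | inj₁ vq-c = dist-mono (m≤n+m 1 2) (dist1 x∈S q∈S (v-c⇒x-d rq vq-c))
        ... | inj₂ vq-d with q ≟ r | q ≟ b
        ...   | yes refl | _        = dist-mono (m≤n+m 1 2) x-r
        ...   | no _     | yes refl = dist-mono (m≤n+m 2 1) (dist-trans x-r r-b)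
        ...   | no q≢r   | no q≢b
          with coloured-either c≢d (adj-rest r∈S rq q≢r) | coloured-either c≢d (adj-rest b∈S rq q≢b)
        ...     | inj₂ rq-d | _         = dist-mono (m≤n+m 2 1) (dist-trans x-r (dist1 r∈S q∈S rq-d))
        ...     | inj₁ _    | inj₂ bq-d = dist-trans (dist-trans x-r r-b) (dist1 b∈S q∈S bq-d)
        ...     | inj₁ rq-c | inj₁ bq-c =
          ⊥-elim (far (dist-trans (dist-trans (dist1 v∈S r∈S vr-c) (dist1 r∈S q∈S rq-c))
                                  (dist-sym (dist1 b∈S q∈S bq-c))))

        x-all : ∀ {y} → y ∈ S → Dist≤ 3 d x y
        x-all {y} y∈S with y ≟ x | y ≟ v
        ... | yes refl | _        = dist-mono z≤n dist0
        ... | no _     | yes refl = dist-trans (dist-trans x-r r-b) (dist-sym (dist1 v∈S b∈S vb-d))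
        ... | no y≢x   | no y≢v   = x-rest (y∈S , y≢v , y≢x)

        spans : Spans d
        spans {y} {z} y∈S z∈S with y ≟ x | z ≟ x
        ... | yes refl | _        = x-all z∈S
        ... | no _     | yes refl = dist-sym (x-all y∈S)
        ... | no y≢x   | no z≢x   =
          double-star-dist v∈S b∈S (inj₂ vb-d) y∈S (near y∈S y≢x) z∈S (near z∈S z≢x)

    module _ {v x : Fin n} (v∈S : v ∈ S) (x∈S : x ∈ S) (near-clique : CliqueMinusEdge v x) where

      private
        near-clique′ : CliqueMinusEdge x v
        near-clique′ y∈S z∈S y≢z = Sum.map₂ Sum.swap (near-clique y∈S z∈S y≢z)

      -- A far pair avoiding both ends is an edge whose ends are adjacent to all other vertices of
      -- `S`, hence dominating in `d`; a pair with exactly one end falls under `far-from-end`. Only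
      -- the pair `v`, `x` itself remains.
      far⇒far-ends : ∀ {c d y z} → c ≢ d → y ∈ S → z ∈ S → ¬ Dist≤ 3 c y z →
        (∃ Spans ⊎ Split v x) ⊎ ¬ Dist≤ 3 c v x
      far⇒far-ends {c} {d} {y} {z} c≢d y∈S z∈S far with y ≟ v | y ≟ x | z ≟ v | z ≟ x
      ... | yes refl | _        | yes refl | _        = ⊥-elim (far⇒≢ far refl)
      ... | yes refl | _        | no _     | yes refl = inj₂ far
      ... | yes refl | _        | no z≢v   | no z≢x   =
        inj₁ (far-from-end near-clique c≢d v∈S x∈S (z∈S , z≢v , z≢x) far)
      ... | no _     | yes refl | yes refl | _        = inj₂ (far ∘ dist-sym)
      ... | no _     | yes refl | no _     | yes refl = ⊥-elim (far⇒≢ far refl)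
      ... | no _     | yes refl | no z≢v   | no z≢x   =
        inj₁ (Sum.map₂ split-swap (far-from-end near-clique′ c≢d x∈S v∈S (z∈S , z≢x , z≢v) far))
      ... | no y≢v   | no y≢x   | yes refl | _        =
        inj₁ (far-from-end near-clique c≢d v∈S x∈S (y∈S , y≢v , y≢x) (far ∘ dist-sym))
      ... | no y≢v   | no y≢x   | no _     | yes refl =
        inj₁ (Sum.map₂ split-swap
          (far-from-end near-clique′ c≢d x∈S v∈S (y∈S , y≢x , y≢v) (far ∘ dist-sym)))
      ... | no y≢v   | no y≢x   | no z≢v   | no z≢x   =
        inj₁ (inj₁ (d ,
          far⇒dominating c≢d y∈S z∈S (adj-rest near-clique y∈S rz (≢-sym (far⇒≢ far))) far cases))
        where
        ry : Rest v x y
        ry = y∈S , y≢v , y≢x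
        rz : Rest v x z
        rz = z∈S , z≢v , z≢x
        cases : ∀ {t} → t ∈ S → (Near d y t ⊎ Near d z t) ⊎ (Adj G y t × Adj G z t)
        cases {t} t∈S with t ≟ y | t ≟ z
        ... | yes t≡y | _       = inj₁ (inj₁ (inj₁ t≡y))
        ... | no _    | yes t≡z = inj₁ (inj₂ (inj₁ t≡z))
        ... | no t≢y  | no t≢z  =
          inj₂ ( adj-sym G (adj-rest near-clique t∈S ry (≢-sym t≢y))
               , adj-sym G (adj-rest near-clique t∈S rz (≢-sym t≢z)))

      -- No remaining vertex receives the same colour from `v` and `x`. If `v` sent `c` to `q` and
      -- `d` to `r`, then `x` would send the opposite colours, and the edge `qr` would complete
      -- either the `c`-path `v q r x` or the `d`-path `v r q x`. So `v` sends a single colour.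
      far-ends⇒split : ∀ {c d} → c ≢ d → ¬ Dist≤ 3 c v x → ¬ Dist≤ 3 d v x → Split v x
      far-ends⇒split {c} {d} c≢d far-c far-d
        with any? (λ q → rest? v x q ×-dec coloured? c v q)
           | any? (λ r → rest? v x r ×-dec coloured? d v r)
      ... | yes (q , rq@(q∈S , q≢v , q≢x) , vq-c) | yes (r , rr@(r∈S , r≢v , r≢x) , vr-d) =
        ⊥-elim contra
        where
        xq-d : Coloured d x q
        xq-d = other-colour c≢d (adj-rest near-clique x∈S rq q≢x)
                 (far-c ∘ dist-common v∈S q∈S x∈S vq-c)
        xr-c : Coloured c x r
        xr-c = other-colour (≢-sym c≢d) (adj-rest near-clique x∈S rr r≢x)
                 (far-d ∘ dist-common v∈S r∈S x∈S vr-d)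
        contra : ⊥
        contra with r ≟ q
        ... | yes refl = far-c (dist-common v∈S q∈S x∈S vq-c xr-c)
        ... | no r≢q with coloured-either c≢d (adj-rest near-clique q∈S rr r≢q)
        ...   | inj₁ e = far-c (dist-trans (dist-trans (dist1 v∈S q∈S vq-c) (dist1 q∈S r∈S e))
                                           (dist-sym (dist1 x∈S r∈S xr-c)))
        ...   | inj₂ e = far-d (dist-trans (dist-trans (dist1 v∈S r∈S vr-d) (dist-sym (dist1 q∈S r∈S e)))
                                           (dist-sym (dist1 x∈S q∈S xq-d)))
      ... | no no-q | _ = d , c , ≢-sym c≢d , λ rb → v-d rb , x-c rb
        where
        v-d : ∀ {b} → Rest v x b → Coloured d v b
        v-d rb@(_ , b≢v , _) =
          other-colour c≢d (adj-rest near-clique v∈S rb b≢v) λ e → no-q (_ , rb , e)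
        x-c : ∀ {b} → Rest v x b → Coloured c x b
        x-c rb@(b∈S , _ , b≢x) =
          other-colour (≢-sym c≢d) (adj-rest near-clique x∈S rb b≢x)
            (far-d ∘ dist-common v∈S b∈S x∈S (v-d rb))
      ... | yes _ | no no-r = c , d , c≢d , λ rb → v-c rb , x-d rb
        where
        v-c : ∀ {b} → Rest v x b → Coloured c v b
        v-c rb@(_ , b≢v , _) =
          other-colour (≢-sym c≢d) (adj-rest near-clique v∈S rb b≢v) λ e → no-r (_ , rb , e)
        x-d : ∀ {b} → Rest v x b → Coloured d x b
        x-d rb@(b∈S , _ , b≢x) =
          other-colour c≢d (adj-rest near-clique x∈S rb b≢x)
            (far-c ∘ dist-common v∈S b∈S x∈S (v-c rb))

      -- If neither colour spans, each has a far pair. Unless one of these settles the matter, `v`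
      -- and `x` are far apart in both colours.
      clique-minus-edge-spanned : ∃ Spans ⊎ Split v x
      clique-minus-edge-spanned with spans-or-far zero | spans-or-far (suc zero)
      ... | inj₁ spans | _          = inj₁ (_ , spans)
      ... | inj₂ _     | inj₁ spans = inj₁ (_ , spans)
      ... | inj₂ (_ , _ , y∈S , z∈S , far) | inj₂ (_ , _ , y′∈S , z′∈S , far′)
        with far⇒far-ends {d = suc zero} (λ ()) y∈S z∈S far
           | far⇒far-ends {d = zero} (λ ()) y′∈S z′∈S far′
      ...   | inj₁ done  | _          = done
      ...   | inj₂ _     | inj₁ done  = done
      ...   | inj₂ far-0 | inj₂ far-1 = inj₂ (far-ends⇒split (λ ()) far-0 far-1)

  -- Covers from spanned sets and stars.

  Spanned : Subset n → Set
  Spanned S = ∃[ ne ] ∃ (Span.Spans S ne)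

  cover : ∀ {S T} → Spanned S → Spanned T → (∀ y → y ∈ S ⊎ y ∈ T) → HasCover χ 3 3
  cover {S} {T} (neS , c , spansS) (neT , d , spansT) covers =
    Span.Mono S neS c , Span.Mono T neT d ,
    Span.mono S neS c , diameterAtMost spansS ,
    Span.mono T neT d , diameterAtMost spansT ,
    ⊆-antisym ⊆⊤ (λ {y} _ → x∈p∪q⁺ (covers y))

  star : ∀ {S c u} → u ∈ S → (∀ {y} → y ∈ S → Near c u y) → Spanned S
  star {S} {c} u∈S near =
    (_ , u∈S) , c , Span.double-star S (_ , u∈S) u∈S u∈S (inj₁ refl) (inj₁ ∘ near)

  clique : (K : Subgraph G) → IsComplete K → Spanned (vertices K)
  clique K complete = nonempty K ,
    Span.clique-spanned (vertices K) (nonempty K) λ u∈ w∈ u≢w → edge⇒adj K (complete u∈ w∈ u≢w)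

  -- `Split` for `K` together with `v`, restated over `K`: as `v` lies outside `K`, the condition
  -- `b ≢ v` becomes automatic.
  SplitOver : Subset n → Fin 2 → Fin 2 → Rel (Fin n) 0ℓ
  SplitOver K c d v x = ∀ {b} → b ∈ K → b ≢ x → Coloured c v b × Coloured d x b

  clique-extended : ∀ {v} (K : Subgraph G) → IsComplete K → v ∉ vertices K →
    ((x , _) : AdjacentToAllButOne v K) →
    Spanned (vertices K ∪ ⁅ v ⁆) ⊎ (∃[ c ] ∃[ d ] (c ≢ d × SplitOver (vertices K) c d v x))
  clique-extended {v} K complete v∉K (x , x∈K , _ , v-adj) =
    Sum.map ((_ , v∈S) ,_)
      (λ (c , d , c≢d , split) → c , d , c≢d ,
         λ {b} b∈K b≢x → split (K⊆S b∈K , (λ { refl → v∉K b∈K }) , b≢x))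
      (Span.clique-minus-edge-spanned S (_ , v∈S) v∈S (K⊆S x∈K) near-clique)
    where
    S : Subset n
    S = vertices K ∪ ⁅ v ⁆
    v∈S : v ∈ S
    v∈S = x∈p∪q⁺ (inj₂ (x∈⁅x⁆ v))
    K⊆S : ∀ {y} → y ∈ vertices K → y ∈ S
    K⊆S = x∈p∪q⁺ ∘ inj₁
    member : ∀ {y} → y ∈ S → y ∈ vertices K ⊎ y ≡ v
    member = Sum.map₂ (x∈⁅y⁆⇒x≡y v) ∘ x∈p∪q⁻ (vertices K) ⁅ v ⁆
    near-clique : Span.CliqueMinusEdge S (_ , v∈S) v x
    near-clique {y} {z} y∈S z∈S y≢z with member y∈S | member z∈S
    ... | inj₁ y∈K  | inj₁ z∈K  = inj₁ (edge⇒adj K (complete y∈K z∈K y≢z))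
    ... | inj₂ refl | inj₂ refl = ⊥-elim (y≢z refl)
    ... | inj₂ refl | inj₁ z∈K with z ≟ x
    ...   | yes z≡x = inj₂ (inj₁ (refl , z≡x))
    ...   | no z≢x  = inj₁ (v-adj z∈K z≢x)
    near-clique {y} {z} y∈S z∈S y≢z | inj₁ y∈K | inj₂ refl with y ≟ x
    ...   | yes y≡x = inj₂ (inj₂ (y≡x , refl))
    ...   | no y≢x  = inj₁ (adj-sym G (v-adj y∈K y≢x))

  module _ {K L : Subset n} {v x y : Fin n} (x∈K : x ∈ K) (y∈L : y ∈ L)
           (cases : ∀ z → z ≡ v ⊎ (z ∈ K ⊎ z ∈ L)) where

    -- The star at `v` in colour `c` reaches everything except `x` and `y`, and the edge `xy` covers
    -- these two in its own colour.
    cover-same : ∀ {c d d′} → SplitOver K c d v x → SplitOver L c d′ v y →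
      Adj G x y → v ≢ x → v ≢ y → HasCover χ 3 3
    cover-same {c} splitK splitL e v≢x v≢y =
      cover (star {⊤ - x - y} {c} (x∈p∧x≢y⇒x∈p-y (x∈p∧x≢y⇒x∈p-y ∈⊤ v≢x) v≢y) near)
            (star {⁅ x ⁆ ∪ ⁅ y ⁆} {colour χ e} (x∈p∪q⁺ (inj₁ (x∈⁅x⁆ x))) near′)
            covers
      where
      near : ∀ {z} → z ∈ ⊤ - x - y → Near c v z
      near {z} z∈ with cases z
      ... | inj₁ z≡v        = inj₁ z≡v
      ... | inj₂ (inj₁ z∈K) = inj₂ (proj₁ (splitK z∈K (x∈p-y⇒x≢y ⊤ (p─q⊆p (⊤ - x) ⁅ y ⁆ z∈))))
      ... | inj₂ (inj₂ z∈L) = inj₂ (proj₁ (splitL z∈L (x∈p-y⇒x≢y (⊤ - x) z∈)))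
      near′ : ∀ {z} → z ∈ ⁅ x ⁆ ∪ ⁅ y ⁆ → Near (colour χ e) x z
      near′ z∈ with x∈p∪q⁻ ⁅ x ⁆ ⁅ y ⁆ z∈
      ... | inj₁ z∈x = inj₁ (x∈⁅y⁆⇒x≡y x z∈x)
      ... | inj₂ z∈y with x∈⁅y⁆⇒x≡y y z∈y
      ...   | refl = inj₂ (e , refl)
      covers : ∀ z → z ∈ ⊤ - x - y ⊎ z ∈ ⁅ x ⁆ ∪ ⁅ y ⁆
      covers z with z ≟ x | z ≟ y
      ... | yes refl | _        = inj₂ (x∈p∪q⁺ (inj₁ (x∈⁅x⁆ z)))
      ... | no _     | yes refl = inj₂ (x∈p∪q⁺ (inj₂ (x∈⁅x⁆ z)))
      ... | no z≢x   | no z≢y   = inj₁ (x∈p∧x≢y⇒x∈p-y (x∈p∧x≢y⇒x∈p-y ∈⊤ z≢x) z≢y)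

    -- Two stars of colour `c` suffice: `y` reaches the rest of `L` and also `x`, while `v` reaches
    -- the rest of `K`.
    cover-opposite : ∀ {c d} → SplitOver K c d v x → SplitOver L d c v y →
      Coloured c x y → HasCover χ 3 3
    cover-opposite {c} splitK splitL xy-c =
      cover (star {L ∪ ⁅ x ⁆} {c} (x∈p∪q⁺ (inj₁ y∈L)) near)
            (star {(K - x) ∪ ⁅ v ⁆} {c} (x∈p∪q⁺ (inj₂ (x∈⁅x⁆ v))) near′)
            covers
      where
      near : ∀ {z} → z ∈ L ∪ ⁅ x ⁆ → Near c y z
      near {z} z∈ with x∈p∪q⁻ L ⁅ x ⁆ z∈ | z ≟ y
      ... | _        | yes z≡y = inj₁ z≡y
      ... | inj₁ z∈L | no z≢y  = inj₂ (proj₂ (splitL z∈L z≢y))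
      ... | inj₂ z∈x | no _ with x∈⁅y⁆⇒x≡y x z∈x
      ...   | refl = inj₂ (coloured-sym xy-c)
      near′ : ∀ {z} → z ∈ (K - x) ∪ ⁅ v ⁆ → Near c v z
      near′ z∈ with x∈p∪q⁻ (K - x) ⁅ v ⁆ z∈
      ... | inj₁ z∈K-x = inj₂ (proj₁ (splitK (p─q⊆p K ⁅ x ⁆ z∈K-x) (x∈p-y⇒x≢y K z∈K-x)))
      ... | inj₂ z∈v   = inj₁ (x∈⁅y⁆⇒x≡y v z∈v)
      covers : ∀ z → z ∈ L ∪ ⁅ x ⁆ ⊎ z ∈ (K - x) ∪ ⁅ v ⁆
      covers z with cases z | z ≟ x
      ... | _               | yes refl = inj₁ (x∈p∪q⁺ (inj₂ (x∈⁅x⁆ z)))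
      ... | inj₁ refl       | no _     = inj₂ (x∈p∪q⁺ (inj₂ (x∈⁅x⁆ z)))
      ... | inj₂ (inj₁ z∈K) | no z≢x   = inj₂ (x∈p∪q⁺ (inj₁ (x∈p∧x≢y⇒x∈p-y z∈K z≢x)))
      ... | inj₂ (inj₂ z∈L) | no _     = inj₁ (x∈p∪q⁺ (inj₁ z∈L))

-- Independence number two, and assembly of the cover.

-- Otherwise the three vertices form an independent set; deleting them in turn lowers its
-- cardinality three times, so it has more than two elements.
no-independent-triple : ∀ {n} {G : Graph n} → IsIndependenceNumber G 2 →
  ∀ {u w x} → u ≢ w → u ≢ x → w ≢ x → ¬ Adj G u w → ¬ Adj G u x → Adj G w x
no-independent-triple {G = G} (_ , bound) {u} {w} {x} u≢w u≢x w≢x ¬uw ¬ux =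
  decidable-stable (adj? G w x) λ ¬wx → <⇒≱ three (bound T (independent ¬wx))
  where
  T : Subset _
  T = ⁅ u ⁆ ∪ (⁅ w ⁆ ∪ ⁅ x ⁆)
  u∈T : u ∈ T
  u∈T = x∈p∪q⁺ (inj₁ (x∈⁅x⁆ u))
  w∈T : w ∈ T - u
  w∈T = x∈p∧x≢y⇒x∈p-y (x∈p∪q⁺ (inj₂ (x∈p∪q⁺ (inj₁ (x∈⁅x⁆ w))))) (≢-sym u≢w)
  x∈T : x ∈ T - u - w
  x∈T = x∈p∧x≢y⇒x∈p-y
          (x∈p∧x≢y⇒x∈p-y (x∈p∪q⁺ (inj₂ (x∈p∪q⁺ (inj₂ (x∈⁅x⁆ x))))) (≢-sym u≢x))
          (≢-sym w≢x)
  three : 2 < ∣ T ∣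
  three = ≤-trans (s≤s (≤-trans (s≤s (≤-trans (s≤s z≤n) (x∈p⇒∣p-x∣<∣p∣ x∈T))) (x∈p⇒∣p-x∣<∣p∣ w∈T)))
                  (x∈p⇒∣p-x∣<∣p∣ u∈T)
  member : ∀ {y} → y ∈ T → y ≡ u ⊎ (y ≡ w ⊎ y ≡ x)
  member = Sum.map (x∈⁅y⁆⇒x≡y u) (Sum.map (x∈⁅y⁆⇒x≡y w) (x∈⁅y⁆⇒x≡y x) ∘ x∈p∪q⁻ ⁅ w ⁆ ⁅ x ⁆)
           ∘ x∈p∪q⁻ ⁅ u ⁆ (⁅ w ⁆ ∪ ⁅ x ⁆)
  independent : ¬ Adj G w x → IsIndependent G T
  independent ¬wx y∈T z∈T with member y∈T | member z∈T
  ... | inj₁ refl        | inj₁ refl        = adj-irref G refl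
  ... | inj₁ refl        | inj₂ (inj₁ refl) = ¬uw
  ... | inj₁ refl        | inj₂ (inj₂ refl) = ¬ux
  ... | inj₂ (inj₁ refl) | inj₁ refl        = ¬uw ∘ adj-sym G
  ... | inj₂ (inj₁ refl) | inj₂ (inj₁ refl) = adj-irref G refl
  ... | inj₂ (inj₁ refl) | inj₂ (inj₂ refl) = ¬wx
  ... | inj₂ (inj₂ refl) | inj₁ refl        = ¬ux ∘ adj-sym G
  ... | inj₂ (inj₂ refl) | inj₂ (inj₁ refl) = ¬wx ∘ adj-sym G
  ... | inj₂ (inj₂ refl) | inj₂ (inj₂ refl) = adj-irref G refl

theorem2p2 : ∀ {n : ℕ} (G : Graph n) (χ : TwoColouring G) →
    IsIndependenceNumber G 2 →
    (v : Fin n) (K′ K″ : Subgraph G) →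
    IsComplete K′ → IsComplete K″ →
    Empty (vertices K′ ∩ vertices K″) →
    vertices K′ ∪ vertices K″ ≡ ⊤ - v →
    AdjacentToAllButOne v K′ →
    AdjacentToAllButOne v K″ →
    HasCover χ 3 3
theorem2p2 {n} G χ α≡2 v K′ K″ complete′ complete″ disjoint union
  adj′@(x′ , x′∈K′ , ¬vx′ , _) adj″@(x″ , x″∈K″ , ¬vx″ , _) = result
  where
  open Colours χ

  v∉K′ : v ∉ vertices K′
  v∉K′ v∈K′ = x∉p-x ⊤ (subst (v ∈_) union (x∈p∪q⁺ (inj₁ v∈K′)))

  v∉K″ : v ∉ vertices K″
  v∉K″ v∈K″ = x∉p-x ⊤ (subst (v ∈_) union (x∈p∪q⁺ (inj₂ v∈K″)))

  v≢x′ : v ≢ x′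
  v≢x′ refl = v∉K′ x′∈K′

  v≢x″ : v ≢ x″
  v≢x″ refl = v∉K″ x″∈K″

  x′x″ : Adj G x′ x″
  x′x″ = no-independent-triple {G = G} α≡2 v≢x′ v≢x″
           (λ { refl → disjoint (_ , x∈p∩q⁺ (x′∈K′ , x″∈K″)) }) ¬vx′ ¬vx″

  cases : ∀ z → z ≡ v ⊎ (z ∈ vertices K′ ⊎ z ∈ vertices K″)
  cases z with z ≟ v
  ... | yes z≡v = inj₁ z≡v
  ... | no z≢v  = inj₂ (x∈p∪q⁻ _ _ (subst (z ∈_) (sym union) (x∈p∧x≢y⇒x∈p-y ∈⊤ z≢v)))

  result : HasCover χ 3 3
  result with clique-extended K′ complete′ v∉K′ adj′ | clique-extended K″ complete″ v∉K″ adj″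
  ... | inj₁ spanned | _ = cover spanned (clique K″ complete″) λ z →
    [ (λ { refl → inj₁ (x∈p∪q⁺ (inj₂ (x∈⁅x⁆ z))) }) , Sum.map₁ (x∈p∪q⁺ ∘ inj₁) ]′ (cases z)
  ... | inj₂ _ | inj₁ spanned = cover (clique K′ complete′) spanned λ z →
    [ (λ { refl → inj₂ (x∈p∪q⁺ (inj₂ (x∈⁅x⁆ z))) }) , Sum.map₂ (x∈p∪q⁺ ∘ inj₁) ]′ (cases z)
  -- Both sides are exceptional: `v` sends either the same colour to both cliques or opposite
  -- colours.
  ... | inj₂ (c , d , c≢d , split′) | inj₂ (c′ , d′ , c′≢d′ , split″)
    with one-of-two c≢d c′ | one-of-two c≢d d′
  ...   | inj₁ refl | _         =
    cover-same x′∈K′ x″∈K″ cases split′ split″ x′x″ v≢x′ v≢x″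
  ...   | inj₂ refl | inj₂ refl = ⊥-elim (c′≢d′ refl)
  ...   | inj₂ refl | inj₁ refl with coloured-either c≢d x′x″
  ...     | inj₁ e = cover-opposite x′∈K′ x″∈K″ cases split′ split″ e
  -- Interchanging the two cliques also interchanges the colours, which reduces this to the previous
  -- case.
  ...     | inj₂ e =
    cover-opposite x″∈K″ x′∈K′ (Sum.map₂ Sum.swap ∘ cases) split″ split′ (coloured-sym e)
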